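{- Let $\varphi=(1+\sqrt5)/2$. For every $\delta>0$ there exist instances $\mathcal{I}$ of the oblivious knapsack problem in which all items have unit density and for which no policy (universal or not) achieves a robustness factor of $\varphi-\delta$.
   Context: An instance of the oblivious knapsack problem is a finite set $\mathcal{I}$ of $n$ items; each item $i$ has a value $v(i)\in\mathbb{Q}_{\ge 0}$ and a size $l(i)\in\mathbb{Q}_{>0}$; all items have unit density if $v(i)=l(i)$ for all $i\in\mathcal{I}$. For $S\subseteq\mathcal{I}$ put $v(S)=\sum_{i\in S}v(i)$ and $l(S)=\sum_{i\in S}l(i)$. For a capacity $C\geq 0$, $\textsc{Opt}(\mathcal{I},C)$ denotes a subset $S\subseteq\mathcal{I}$ with $l(S)\le C$ of maximum value. A policy $\mathcal{P}$ for $\mathcal{I}$ is a binary decision tree whose nodes are labeled by items and that contains every item exactly once along each path from the root to a leaf; it does not depend on the capacity. Its packing $\mathcal{P}(C)\subseteq\mathcal{I}$ for capacity $C$ is obtained as follows: start with $\mathcal{P}(C)=\emptyset$ at the root; at a node with item $r$, if $l(r)+l(\mathcal{P}(C))\le C$, add $r$ to $\mathcal{P}(C)$ and continue with the left subtree; otherwise discard $r$ and continue with the right subtree. The policy $\mathcal{P}$ achieves robustness factor $\alpha$ (is $\alpha$-robust) if $v(\textsc{Opt}(\mathcal{I},C))\le\alpha\, v(\mathcal{P}(C))$ for all capacities $C$. A universal policy is one in which every root-to-leaf path carries the same permutation of the items. -}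

module Defs where

import Algebra.Properties.CommutativeMonoid.Sum as CommutativeMonoidSum
open import Data.Bool using (if_then_else_)
open import Data.Fin using (Fin)
open import Data.Fin.Subset using (Subset; ⊥; ⁅_⁆; _∪_)
import Data.Integer as ℤ
import Data.Integer.Properties as ℤ
open import Data.List using (List; []; _∷_)
open import Data.List.Membership.Propositional using (_∈_)
open import Data.List.Relation.Unary.Unique.Propositional using (Unique)
open import Data.Nat as ℕ using (ℕ; zero; suc)
import Data.Nat.Properties as ℕ
open import Data.Nat.Solver using () renaming (module +-*-Solver to ℕ-Solver)
open import Data.Product using (∃; _×_; _,_)
open import Data.Rational
open import Data.Rational.Properties
open import Data.Rational.Solver using () renaming (module +-*-Solver to ℚ-Solver)
import Data.Rational.Unnormalised as ℚᵘ
import Data.Rational.Unnormalised.Properties as ℚᵘ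
open import Data.Sum using (inj₁; inj₂)
open import Data.Vec using (lookup)
open import Relation.Binary.PropositionalEquality
open import Relation.Nullary using (yes; no)

open CommutativeMonoidSum +-0-commutativeMonoid using (sum)

-- Reals as Cauchy sequences of rationals; they are compared only through the
-- orders below, never through _≡_.
IsCauchy : (ℕ → ℚ) → Set
IsCauchy x = ∀ ε → 0ℚ < ε →
  ∃ λ N → ∀ m n → N ℕ.≤ m → N ℕ.≤ n → ∣ x m - x n ∣ ≤ ε

record ℝ : Set where
  constructor mkℝ
  field
    seq    : ℕ → ℚ
    cauchy : IsCauchy seq

open ℝ public

infix  4 _≤ʳ_ _<ʳ_
infixl 6 _+ʳ_ _-ʳ_
infixl 7 _·_
infix  8 -ʳ_

_≤ʳ_ : ℝ → ℝ → Set
x ≤ʳ y = ∀ ε → 0ℚ < ε → ∃ λ N → ∀ n → N ℕ.≤ n → seq x n ≤ seq y n + ε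

_<ʳ_ : ℝ → ℝ → Set
x <ʳ y = ∃ λ ε → 0ℚ < ε × ∃ λ N → ∀ n → N ℕ.≤ n → seq x n + ε ≤ seq y n

private
  shrink : ∀ c ε → 0ℚ ≤ c → 0ℚ < ε → ∃ λ δ → 0ℚ < δ × c * δ ≤ ε
  shrink c ε 0≤c 0<ε = δ , positive⁻¹ δ , (begin
      c * δ              ≤⟨ *-monoʳ-≤-nonNeg δ {{pos⇒nonNeg δ}} c≤d ⟩
      d * (ε * 1/ d)     ≡⟨ cong (d *_) (*-comm ε (1/ d)) ⟩
      d * (1/ d * ε)     ≡⟨ *-assoc d (1/ d) ε ⟨
      d * 1/ d * ε       ≡⟨ cong (_* ε) (*-inverseʳ d) ⟩
      1ℚ * ε             ≡⟨ *-identityˡ ε ⟩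
      ε                  ∎)
    where
    open ≤-Reasoning
    d = c + 1ℚ
    0<d : 0ℚ < d
    0<d = +-mono-≤-< 0≤c (positive⁻¹ 1ℚ)
    c≤d : c ≤ d
    c≤d = subst (_≤ d) (+-identityʳ c) (+-monoʳ-≤ c (nonNegative⁻¹ 1ℚ))
    instance
      _ = positive 0<d
      _ = positive 0<ε
      _ = pos⇒nonZero d
      _ = 1/pos⇒pos d
    δ = ε * 1/ d
    instance
      _ = pos*pos⇒pos ε (1/ d)

  ∣∣-≤ : ∀ {p q ε} → p ≤ q + ε → q ≤ p + ε → ∣ p - q ∣ ≤ ε
  ∣∣-≤ {p} {q} {ε} p≤ q≤ with ∣p∣≡p∨∣p∣≡-p (p - q)
  ... | inj₁ eq = subst (_≤ ε) (sym eq)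
    (subst (p - q ≤_) (solve 2 (λ q e → q :+ e :+ :- q := e) refl q ε) (+-monoˡ-≤ (- q) p≤))
    where open ℚ-Solver
  ... | inj₂ eq = subst (_≤ ε) (sym (trans eq (solve 2 (λ p q → :- (p :+ :- q) := q :+ :- p) refl p q)))
    (subst (q - p ≤_) (solve 2 (λ q e → q :+ e :+ :- q := e) refl p ε) (+-monoˡ-≤ (- p) q≤))
    where open ℚ-Solver

fromℚ : ℚ → ℝ
fromℚ q = mkℝ (λ _ → q) λ ε 0<ε → 0 , λ _ _ _ _ →
  subst (_≤ ε) (sym (cong ∣_∣ (+-inverseʳ q))) (<⇒≤ 0<ε)

_+ʳ_ : ℝ → ℝ → ℝ
x +ʳ y = mkℝ (λ n → seq x n + seq y n) λ ε 0<ε →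
  let δ , 0<δ , 2δ≤ε = shrink (1ℚ + 1ℚ) ε (nonNegative⁻¹ _) 0<ε
      N₁ , h₁ = cauchy x δ 0<δ
      N₂ , h₂ = cauchy y δ 0<δ
  in N₁ ℕ.⊔ N₂ , λ m n N≤m N≤n → begin
    ∣ seq x m + seq y m - (seq x n + seq y n) ∣
      ≡⟨ cong ∣_∣ (solve 4 (λ a b c d → a :+ b :+ :- (c :+ d) := (a :+ :- c) :+ (b :+ :- d))
                     refl (seq x m) (seq y m) (seq x n) (seq y n)) ⟩
    ∣ (seq x m - seq x n) + (seq y m - seq y n) ∣
      ≤⟨ ∣p+q∣≤∣p∣+∣q∣ (seq x m - seq x n) (seq y m - seq y n) ⟩
    ∣ seq x m - seq x n ∣ + ∣ seq y m - seq y n ∣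
      ≤⟨ +-mono-≤ (h₁ m n (ℕ.m⊔n≤o⇒m≤o N₁ N₂ N≤m) (ℕ.m⊔n≤o⇒m≤o N₁ N₂ N≤n))
                  (h₂ m n (ℕ.m⊔n≤o⇒n≤o N₁ N₂ N≤m) (ℕ.m⊔n≤o⇒n≤o N₁ N₂ N≤n)) ⟩
    δ + δ
      ≡⟨ solve 1 (λ d → d :+ d := (con 1ℚ :+ con 1ℚ) :* d) refl δ ⟩
    (1ℚ + 1ℚ) * δ
      ≤⟨ 2δ≤ε ⟩
    ε ∎
  where
  open ≤-Reasoning
  open ℚ-Solver

_·_ : ℚ → ℝ → ℝ
p · x = mkℝ (λ n → p * seq x n) λ ε 0<ε →
  let δ , 0<δ , pδ≤ε = shrink ∣ p ∣ ε (0≤∣p∣ p) 0<ε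
      N , h = cauchy x δ 0<δ
  in N , λ m n N≤m N≤n → begin
    ∣ p * seq x m - p * seq x n ∣
      ≡⟨ cong ∣_∣ (solve 3 (λ p a b → p :* a :+ :- (p :* b) := p :* (a :+ :- b))
                     refl p (seq x m) (seq x n)) ⟩
    ∣ p * (seq x m - seq x n) ∣
      ≡⟨ ∣p*q∣≡∣p∣*∣q∣ p (seq x m - seq x n) ⟩
    ∣ p ∣ * ∣ seq x m - seq x n ∣
      ≤⟨ *-monoˡ-≤-nonNeg ∣ p ∣ {{∣-∣-nonNeg p}} (h m n N≤m N≤n) ⟩
    ∣ p ∣ * δ
      ≤⟨ pδ≤ε ⟩
    ε ∎
  where
  open ≤-Reasoning
  open ℚ-Solver

-ʳ_ : ℝ → ℝ
-ʳ x = - 1ℚ · x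

_-ʳ_ : ℝ → ℝ → ℝ
x -ʳ y = x +ʳ -ʳ y

isqrt-step : ℕ → ℕ → ℕ
isqrt-step m r with suc r ℕ.* suc r ℕ.≤? m
... | yes _ = suc r
... | no  _ = r

isqrt : ℕ → ℕ
isqrt zero    = 0
isqrt (suc m) = isqrt-step (suc m) (isqrt m)

isqrt-lower : ∀ m → isqrt m ℕ.* isqrt m ℕ.≤ m
isqrt-lower zero    = ℕ.z≤n
isqrt-lower (suc m) with suc (isqrt m) ℕ.* suc (isqrt m) ℕ.≤? suc m
... | yes p = p
... | no  _ = ℕ.m≤n⇒m≤1+n (isqrt-lower m)

isqrt-upper : ∀ m → m ℕ.< suc (isqrt m) ℕ.* suc (isqrt m)
isqrt-upper zero    = ℕ.s≤s ℕ.z≤n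
isqrt-upper (suc m) with suc (isqrt m) ℕ.* suc (isqrt m) ℕ.≤? suc m
... | yes _ = ℕ.≤-<-trans (isqrt-upper m) (ℕ.*-mono-< r<1+r r<1+r)
  where r<1+r = ℕ.n<1+n (suc (isqrt m))
... | no ¬p = ℕ.≰⇒> ¬p

-- The n-th approximation to √k is ⌊√(k(n+1)²)⌋/(n+1): the largest multiple of
-- 1/(n+1) whose square is at most k.
√-seq : ℕ → ℕ → ℚ
√-seq k n = ℤ.+ isqrt (k ℕ.* (suc n ℕ.* suc n)) / suc n

private
  square-cancel-< : ∀ a b → a ℕ.* a ℕ.< b ℕ.* b → a ℕ.< b
  square-cancel-< a b a²<b² = ℕ.≰⇒> λ b≤a → ℕ.<⇒≱ a²<b² (ℕ.*-mono-≤ b≤a b≤a)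

  isqrt-cross : ∀ k m n →
    isqrt (k ℕ.* (suc m ℕ.* suc m)) ℕ.* suc n ℕ.≤ suc (isqrt (k ℕ.* (suc n ℕ.* suc n))) ℕ.* suc m
  isqrt-cross k m n = ℕ.<⇒≤ (square-cancel-< _ _ (begin-strict
      (r ℕ.* N) ℕ.* (r ℕ.* N)               ≡⟨ swap r N ⟩
      (r ℕ.* r) ℕ.* (N ℕ.* N)               ≤⟨ ℕ.*-monoˡ-≤ (N ℕ.* N) (isqrt-lower (k ℕ.* (M ℕ.* M))) ⟩
      k ℕ.* (M ℕ.* M) ℕ.* (N ℕ.* N)         ≡⟨ solve 3 (λ k a b → k :* a :* b := k :* b :* a) refl k (M ℕ.* M) (N ℕ.* N) ⟩
      k ℕ.* (N ℕ.* N) ℕ.* (M ℕ.* M)         <⟨ ℕ.*-monoˡ-< (M ℕ.* M) (isqrt-upper (k ℕ.* (N ℕ.* N))) ⟩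
      (suc s ℕ.* suc s) ℕ.* (M ℕ.* M)       ≡⟨ swap (suc s) M ⟨
      (suc s ℕ.* M) ℕ.* (suc s ℕ.* M)       ∎))
    where
    open ℕ.≤-Reasoning
    open ℕ-Solver
    M = suc m
    N = suc n
    r = isqrt (k ℕ.* (M ℕ.* M))
    s = isqrt (k ℕ.* (N ℕ.* N))
    swap : ∀ a b → (a ℕ.* b) ℕ.* (a ℕ.* b) ≡ (a ℕ.* a) ℕ.* (b ℕ.* b)
    swap = solve 2 (λ a b → (a :* b) :* (a :* b) := (a :* a) :* (b :* b)) refl

  /-mono-≤ : ∀ a b m n → a ℕ.* suc n ℕ.≤ b ℕ.* suc m → ℤ.+ a / suc m ≤ ℤ.+ b / suc n
  /-mono-≤ a b m n h = toℚᵘ-cancel-≤ (begin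
      toℚᵘ (ℤ.+ a / suc m)  ≃⟨ toℚᵘ-fromℚᵘ (ℚᵘ.mkℚᵘ (ℤ.+ a) m) ⟩
      ℚᵘ.mkℚᵘ (ℤ.+ a) m     ≤⟨ ℚᵘ.*≤* (subst₂ ℤ._≤_ (ℤ.pos-* a (suc n)) (ℤ.pos-* b (suc m)) (ℤ.+≤+ h)) ⟩
      ℚᵘ.mkℚᵘ (ℤ.+ b) n     ≃⟨ toℚᵘ-fromℚᵘ (ℚᵘ.mkℚᵘ (ℤ.+ b) n) ⟨
      toℚᵘ (ℤ.+ b / suc n)  ∎)
    where open ℚᵘ.≤-Reasoning

  /-suc : ∀ b n → ℤ.+ suc b / suc n ≡ ℤ.+ b / suc n + ℤ.+ 1 / suc n
  /-suc b n = toℚᵘ-injective (begin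
      toℚᵘ (ℤ.+ suc b / suc n)
        ≈⟨ toℚᵘ-fromℚᵘ (ℚᵘ.mkℚᵘ (ℤ.+ suc b) n) ⟩
      ℚᵘ.mkℚᵘ (ℤ.+ suc b) n
        ≈⟨ ℚᵘ.*≡* (eq b n) ⟩
      ℚᵘ.mkℚᵘ (ℤ.+ b) n ℚᵘ.+ ℚᵘ.mkℚᵘ (ℤ.+ 1) n
        ≈⟨ ℚᵘ.+-cong (toℚᵘ-fromℚᵘ (ℚᵘ.mkℚᵘ (ℤ.+ b) n)) (toℚᵘ-fromℚᵘ (ℚᵘ.mkℚᵘ (ℤ.+ 1) n)) ⟨
      toℚᵘ (ℤ.+ b / suc n) ℚᵘ.+ toℚᵘ (ℤ.+ 1 / suc n)
        ≈⟨ toℚᵘ-homo-+ (ℤ.+ b / suc n) (ℤ.+ 1 / suc n) ⟨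
      toℚᵘ (ℤ.+ b / suc n + ℤ.+ 1 / suc n) ∎)
    where
    open import Relation.Binary.Reasoning.Setoid ℚᵘ.≃-setoid
    eq : ∀ b n → ℤ.+ suc b ℤ.* ℤ.+ (suc n ℕ.* suc n)
               ≡ (ℤ.+ b ℤ.* ℤ.+ suc n ℤ.+ ℤ.+ 1 ℤ.* ℤ.+ suc n) ℤ.* ℤ.+ suc n
    eq b n = trans (cong (ℤ.+ suc b ℤ.*_) (ℤ.pos-* (suc n) (suc n)))
      (trans (sym (ℤ.*-assoc (ℤ.+ suc b) (ℤ.+ suc n) (ℤ.+ suc n)))
        (cong (ℤ._* ℤ.+ suc n)
          (trans (cong (ℤ._* ℤ.+ suc n) (ℤ.+-comm (ℤ.+ 1) (ℤ.+ b)))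
            (ℤ.*-distribʳ-+ (ℤ.+ suc n) (ℤ.+ b) (ℤ.+ 1)))))

  1/-small : ∀ ε → 0ℚ < ε → ∃ λ N → ∀ n → N ℕ.≤ n → ℤ.+ 1 / suc n ≤ ε
  1/-small ε 0<ε with positive 0<ε
  1/-small (mkℚ (ℤ.+[1+ p ]) d c) 0<ε | _ = d , λ n d≤n →
    subst (ℤ.+ 1 / suc n ≤_) (fromℚᵘ-toℚᵘ (mkℚ ℤ.+[1+ p ] d c))
      (/-mono-≤ 1 (suc p) n d
        (ℕ.*-mono-≤ {1} {suc p} (ℕ.s≤s ℕ.z≤n) (ℕ.s≤s d≤n)))

  √-close : ∀ k ε m n → ℤ.+ 1 / suc n ≤ ε → √-seq k m ≤ √-seq k n + ε
  √-close k ε m n 1/n≤ε = begin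
      √-seq k m                     ≤⟨ /-mono-≤ (isqrt (k ℕ.* (suc m ℕ.* suc m))) (suc s) m n (isqrt-cross k m n) ⟩
      ℤ.+ suc s / suc n             ≡⟨ /-suc s n ⟩
      √-seq k n + ℤ.+ 1 / suc n     ≤⟨ +-monoʳ-≤ (√-seq k n) 1/n≤ε ⟩
      √-seq k n + ε                 ∎
    where
    open ≤-Reasoning
    s = isqrt (k ℕ.* (suc n ℕ.* suc n))

√ : ℕ → ℝ
√ k = mkℝ (√-seq k) λ ε 0<ε →
  let N , h = 1/-small ε 0<ε
  in N , λ m n N≤m N≤n → ∣∣-≤ {√-seq k m} {√-seq k n}
       (√-close k ε m n (h n N≤n)) (√-close k ε n m (h m N≤m))

φ : ℝ
φ = ½ · (fromℚ 1ℚ +ʳ √ 5)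

record Instance : Set where
  field
    n       : ℕ
    value   : Fin n → ℚ
    size    : Fin n → ℚ
    value≥0 : ∀ i → 0ℚ ≤ value i
    size>0  : ∀ i → 0ℚ < size i

  v : Subset n → ℚ
  v S = sum λ i → if lookup S i then value i else 0ℚ

  l : Subset n → ℚ
  l S = sum λ i → if lookup S i then size i else 0ℚ

  UnitDensity : Set
  UnitDensity = ∀ i → value i ≡ size i

  IsOpt : ℚ → Subset n → Set
  IsOpt C S = l S ≤ C × (∀ T → l T ≤ C → v T ≤ v S)

-- Leaves carry no item: they mark the end of the process, so every item
-- occurring on a path labels an inner node with two children.
data Tree (A : Set) : Set where
  leaf : Tree A
  node : A → (left right : Tree A) → Tree A

data Path {A : Set} : Tree A → List A → Set where
  end     : Path leaf []
  goLeft  : ∀ {r t u p} → Path t p → Path (node r t u) (r ∷ p)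
  goRight : ∀ {r t u p} → Path u p → Path (node r t u) (r ∷ p)

module _ (I : Instance) where
  open Instance I

  record Policy : Set where
    field
      tree        : Tree (Fin n)
      exactlyOnce : ∀ {p} → Path tree p → Unique p × (∀ i → i ∈ p)

  open Policy

  packFrom : Subset n → Tree (Fin n) → ℚ → Subset n
  packFrom S leaf         C = S
  packFrom S (node r t u) C with size r + l S ≤? C
  ... | yes _ = packFrom (S ∪ ⁅ r ⁆) t C
  ... | no  _ = packFrom S u C

  -- Capacities are rational, like the sizes: l takes finitely many rational
  -- values, so a real capacity C acts as the largest value of l that is ≤ C.
  packing : Policy → ℚ → Subset n
  packing P C = packFrom ⊥ (tree P) C

  Robust : ℝ → Policy → Set
  Robust α P = ∀ C → 0ℚ ≤ C → ∀ S → IsOpt C S →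
    fromℚ (v S) ≤ʳ v (packing P C) · α

{-# OPTIONS --safe #-}

-- Take unit-density items of sizes a, a, c, d, e proportional to t³, t³, 2t²,
-- t² + 2t, 3t + 2, where t is a rational slightly below φ. Then e ≥ t·a,
-- 2a = t·c, a + c = t·d and c + d = t·e, so for every item r there is a set of
-- other items whose total size is at least t times the size of r. With that
-- total as the capacity, a policy probing r first packs r, and no other item
-- fits beside it because even a smallest one, a, is too large; for r = e this
-- holds because a + e − c − d is proportional to (2 − t)(t + 1 − t²) > 0.
module Submission where

open import Defs
import Algebra.Properties.CommutativeMonoid.Sum as CommutativeMonoidSum
open import Data.Bool using (false; if_then_else_)
open import Data.Fin using (Fin; zero; suc)
open import Data.Fin.Patterns
open import Data.Fin.Subset using (⊥; ⁅_⁆; _∪_)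
open import Data.Fin.Subset.Properties using (∪-identityˡ)
import Data.Integer as ℤ
import Data.Integer.Properties as ℤ
open import Data.List using ([])
open import Data.Nat as ℕ using (suc)
import Data.Nat.Properties as ℕ
open import Data.Nat.Solver using () renaming (module +-*-Solver to ℕ-Solver)
open import Data.Product using (∃; _×_; _,_; proj₁; proj₂)
open import Data.Rational
open import Data.Rational.Properties
open import Data.Rational.Solver using () renaming (module +-*-Solver to ℚ-Solver)
import Data.Rational.Unnormalised as ℚᵘ
import Data.Rational.Unnormalised.Properties as ℚᵘ
open import Data.Sum using (inj₁; inj₂)
open import Data.Vec using (lookup; []; _∷_)
open import Data.Vec.Properties using (lookup-replicate)
open import Relation.Binary.PropositionalEquality
open import Relation.Nullary using (¬_; yes; no; contradiction)

open CommutativeMonoidSum +-0-commutativeMonoid using (sum; sum-cong-≗; sum-replicate-zero)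
open ℚ-Solver

-- Inequalities between rationals.

-- Reduces an inequality to a ring identity: once the difference is exhibited as a visibly
-- nonnegative expression `q`, the solver does the rest. Most polynomial bounds below are obtained
-- in this way or from its strict variant.
p+q≡r⇒p≤r : ∀ {p q r} → 0ℚ ≤ q → p + q ≡ r → p ≤ r
p+q≡r⇒p≤r {p} 0≤q eq = subst₂ _≤_ (+-identityʳ p) eq (+-monoʳ-≤ p 0≤q)

p+q≡r⇒p<r : ∀ {p q r} → 0ℚ < q → p + q ≡ r → p < r
p+q≡r⇒p<r {p} 0<q eq = subst₂ _<_ (+-identityʳ p) eq (+-monoʳ-< p 0<q)

<⇒≱ : ∀ {p q} → p < q → ¬ q ≤ p
<⇒≱ p<q q≤p = <-irrefl refl (<-≤-trans p<q q≤p)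

p≤q⇒0≤q-p : ∀ {p q} → p ≤ q → 0ℚ ≤ q - p
p≤q⇒0≤q-p {p} {q} p≤q = subst (_≤ q - p) (+-inverseʳ p) (+-monoˡ-≤ (- p) p≤q)

p<q⇒0<q-p : ∀ {p q} → p < q → 0ℚ < q - p
p<q⇒0<q-p {p} {q} p<q = subst (_< q - p) (+-inverseʳ p) (+-monoˡ-< (- p) p<q)

0<p*q : ∀ {p q} → 0ℚ < p → 0ℚ < q → 0ℚ < p * q
0<p*q {p} {q} 0<p 0<q = positive⁻¹ (p * q) {{pos*pos⇒pos p {{positive 0<p}} q {{positive 0<q}}}}

0≤p*q : ∀ {p q} → 0ℚ ≤ p → 0ℚ ≤ q → 0ℚ ≤ p * q
0≤p*q {p} {q} 0≤p 0≤q =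
  nonNegative⁻¹ (p * q) {{nonNeg*nonNeg⇒nonNeg p {{nonNegative 0≤p}} q {{nonNegative 0≤q}}}}

0<p⊓q : ∀ {p q} → 0ℚ < p → 0ℚ < q → 0ℚ < p ⊓ q
0<p⊓q {p} {q} 0<p 0<q with ⊓-sel p q
... | inj₁ eq = subst (0ℚ <_) (sym eq) 0<p
... | inj₂ eq = subst (0ℚ <_) (sym eq) 0<q

p≤∣p∣ : ∀ p → p ≤ ∣ p ∣
p≤∣p∣ (mkℚ (ℤ.+ _) _ _)        = ≤-refl
p≤∣p∣ p@(mkℚ ℤ.-[1+ _ ] _ _) = ≤-trans (nonPositive⁻¹ p) (0≤∣p∣ p)

∣p-q∣≤r⇒p≤q+r : ∀ p q {r} → ∣ p - q ∣ ≤ r → p ≤ q + r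
∣p-q∣≤r⇒p≤q+r p q {r} h = subst (_≤ q + r)
  (solve 2 (λ p q → q :+ (p :+ :- q) := p) refl p q)
  (+-monoʳ-≤ q (≤-trans (p≤∣p∣ (p - q)) h))

-- Rational approximations to `√ 5` and `φ`.

isqrt-max : ∀ a m → a ℕ.* a ℕ.≤ m → a ℕ.≤ isqrt m
isqrt-max a m a²≤m = ℕ.≮⇒≥ λ r<a →
  ℕ.<⇒≱ (isqrt-upper m) (ℕ.≤-trans (ℕ.*-mono-≤ r<a r<a) a²≤m)

√-seq-square : ∀ k n → √-seq k n * √-seq k n ≤ ℤ.+ k / 1
√-seq-square k n = toℚᵘ-cancel-≤ (begin
    toℚᵘ (q * q)                  ≃⟨ toℚᵘ-homo-* q q ⟩
    toℚᵘ q ℚᵘ.* toℚᵘ q            ≃⟨ ℚᵘ.*-cong q≃ q≃ ⟩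
    ℚᵘ.mkℚᵘ (ℤ.+ r) n ℚᵘ.* ℚᵘ.mkℚᵘ (ℤ.+ r) n
                                  ≤⟨ ℚᵘ.*≤* (subst₂ ℤ._≤_ lhs (ℤ.pos-* k (suc n ℕ.* suc n))
                                       (ℤ.+≤+ (isqrt-lower (k ℕ.* (suc n ℕ.* suc n))))) ⟩
    ℚᵘ.mkℚᵘ (ℤ.+ k) 0             ≃⟨ toℚᵘ-fromℚᵘ (ℚᵘ.mkℚᵘ (ℤ.+ k) 0) ⟨
    toℚᵘ (ℤ.+ k / 1)              ∎)
  where
  open ℚᵘ.≤-Reasoning
  r = isqrt (k ℕ.* (suc n ℕ.* suc n))
  q = √-seq k n
  q≃ = toℚᵘ-fromℚᵘ (ℚᵘ.mkℚᵘ (ℤ.+ r) n)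
  lhs : ℤ.+ (r ℕ.* r) ≡ ℤ.+ r ℤ.* ℤ.+ r ℤ.* ℤ.1ℤ
  lhs = trans (ℤ.pos-* r r) (sym (ℤ.*-identityʳ _))

√-seq-lower : ∀ a k n → a ℕ.* a ℕ.≤ k → ℤ.+ a / 1 ≤ √-seq k n
√-seq-lower a k n a²≤k = toℚᵘ-cancel-≤ (begin
    toℚᵘ (ℤ.+ a / 1)   ≃⟨ toℚᵘ-fromℚᵘ (ℚᵘ.mkℚᵘ (ℤ.+ a) 0) ⟩
    ℚᵘ.mkℚᵘ (ℤ.+ a) 0  ≤⟨ ℚᵘ.*≤* (subst₂ ℤ._≤_ (ℤ.pos-* a N) (sym (ℤ.*-identityʳ _))
                             (ℤ.+≤+ (isqrt-max (a ℕ.* N) _ aN²≤kN²))) ⟩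
    ℚᵘ.mkℚᵘ (ℤ.+ isqrt (k ℕ.* (N ℕ.* N))) n
                       ≃⟨ toℚᵘ-fromℚᵘ (ℚᵘ.mkℚᵘ (ℤ.+ isqrt (k ℕ.* (N ℕ.* N))) n) ⟨
    toℚᵘ (√-seq k n)   ∎)
  where
  open ℚᵘ.≤-Reasoning
  N = suc n
  aN²≤kN² : a ℕ.* N ℕ.* (a ℕ.* N) ℕ.≤ k ℕ.* (N ℕ.* N)
  aN²≤kN² = subst (ℕ._≤ k ℕ.* (N ℕ.* N))
    (ℕ-Solver.solve 2 (λ a N → a ℕ-Solver.:* a ℕ-Solver.:* (N ℕ-Solver.:* N)
      ℕ-Solver.:= a ℕ-Solver.:* N ℕ-Solver.:* (a ℕ-Solver.:* N)) refl a N)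
    (ℕ.*-monoˡ-≤ (N ℕ.* N) a²≤k)

-- For x = (1 + r)/2 one has x + 1 - x² = (5 - r²)/4, and the approximations r to `√ 5` never exceed
-- it. So the defining equation of `φ` becomes an inequality valid at every index, not only in the
-- limit.
φ-seq-square : ∀ n → seq φ n * seq φ n ≤ seq φ n + 1ℚ
φ-seq-square n = p+q≡r⇒p≤r
  (0≤p*q {½ * ½} (nonNegative⁻¹ _) (p≤q⇒0≤q-p (√-seq-square 5 n)))
  (solve 1 (λ r → con ½ :* (con 1ℚ :+ r) :* (con ½ :* (con 1ℚ :+ r))
                    :+ con (½ * ½) :* (con (ℤ.+ 5 / 1) :+ :- (r :* r))
                  := con ½ :* (con 1ℚ :+ r) :+ con 1ℚ) refl (√-seq 5 n))

φ-seq-lower : ∀ n → ℤ.+ 3 / 2 ≤ seq φ n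
φ-seq-lower n = *-monoˡ-≤-nonNeg ½ (+-monoʳ-≤ 1ℚ (√-seq-lower 2 5 n (ℕ.m≤m+n 4 1)))

-- An approximation `x` to `φ` satisfies x² ≤ x + 1; lowering it by a small `η` makes this strict,
-- while `x - η` still stays above `α`.
below-φ : ∀ α → α <ʳ φ → ∃ λ t → α <ʳ fromℚ t × ℤ.+ 37 / 25 ≤ t × t * t < t + 1ℚ
below-φ α (ε , 0<ε , N₁ , α+ε≤φ) = x - η , (¼ε , 0<¼ε , N₁ ℕ.⊔ N₂ , α+¼ε≤) , lower , square
  where
  open ≤-Reasoning
  ¼ε = ½ * ½ * ε
  0<¼ε : 0ℚ < ¼ε
  0<¼ε = 0<p*q {½ * ½} (positive⁻¹ _) 0<ε
  ½ε = ½ * ε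
  close = cauchy φ ½ε (0<p*q {½} (positive⁻¹ _) 0<ε)
  N₂ = proj₁ close
  m = N₁ ℕ.⊔ N₂
  x = seq φ m
  1/50 = ℤ.+ 1 / 50
  -- The gap `ε` is split: half pays for replacing `seq φ n` by `x`, a quarter for subtracting `η`,
  -- and a quarter is left between `α` and `x - η`. The cap 1/50 gives 37/25 = 3/2 - 1/50 as lower
  -- bound.
  η = ¼ε ⊓ 1/50
  0<η : 0ℚ < η
  0<η = 0<p⊓q 0<¼ε (positive⁻¹ _)
  α+¼ε≤ : ∀ n → N₁ ℕ.⊔ N₂ ℕ.≤ n → seq α n + ¼ε ≤ x - η
  α+¼ε≤ n N≤n = begin
    seq α n + ¼ε             ≡⟨ solve 2 (λ a e → a :+ con (½ * ½) :* e := a :+ e :+ :- (con (½ * ½ + ½) :* e)) refl (seq α n) ε ⟩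
    seq α n + ε - ¾ε         ≤⟨ +-monoˡ-≤ (- ¾ε) (α+ε≤φ n (ℕ.m⊔n≤o⇒m≤o N₁ N₂ N≤n)) ⟩
    seq φ n - ¾ε             ≤⟨ +-monoˡ-≤ (- ¾ε) (∣p-q∣≤r⇒p≤q+r (seq φ n) x
                                   (proj₂ close n m (ℕ.m⊔n≤o⇒n≤o N₁ N₂ N≤n) (ℕ.m≤n⊔m N₁ N₂))) ⟩
    x + ½ε - ¾ε              ≡⟨ solve 2 (λ x e → x :+ con ½ :* e :+ :- (con (½ * ½ + ½) :* e) := x :+ :- (con (½ * ½) :* e)) refl x ε ⟩
    x - ¼ε                   ≤⟨ +-monoʳ-≤ x (neg-antimono-≤ (p⊓q≤p ¼ε 1/50)) ⟩
    x - η                    ∎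
    where ¾ε = (½ * ½ + ½) * ε
  η≤ : η ≤ 1/50
  η≤ = p⊓q≤q ¼ε 1/50
  lower : ℤ.+ 37 / 25 ≤ x - η
  lower = +-mono-≤ (φ-seq-lower m) (neg-antimono-≤ η≤)
  -- Lowering `x` by `η` decreases x² - x by exactly `η` times this factor, which is at least 3/2 +
  -- 3/2 - 1 - 1/50 = 99/50.
  slope>0 : 0ℚ < x + x - 1ℚ - η
  slope>0 = <-≤-trans (positive⁻¹ (ℤ.+ 99 / 50))
    (+-mono-≤ (+-monoˡ-≤ (- 1ℚ) (+-mono-≤ (φ-seq-lower m) (φ-seq-lower m))) (neg-antimono-≤ η≤))
  square : (x - η) * (x - η) < x - η + 1ℚ
  square = p+q≡r⇒p<r
    (+-mono-≤-< (p≤q⇒0≤q-p (φ-seq-square m)) (0<p*q 0<η slope>0))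
    (solve 2 (λ x h → (x :+ :- h) :* (x :+ :- h)
                      :+ (x :+ con 1ℚ :+ :- (x :* x) :+ h :* (x :+ x :+ :- con 1ℚ :+ :- h))
                    := x :+ :- h :+ con 1ℚ) refl x η)

x-δ<x : ∀ x δ → fromℚ 0ℚ <ʳ δ → x -ʳ δ <ʳ x
x-δ<x x δ (ε , 0<ε , N , ε≤δ) = ε , 0<ε , N , λ n N≤n → p+q≡r⇒p≤r (p≤q⇒0≤q-p (ε≤δ n N≤n))
  (solve 3 (λ x d e → x :+ con (- 1ℚ) :* d :+ e :+ (d :+ :- (con 0ℚ :+ e)) := x)
    refl (seq x n) (seq δ n) ε)

-- Packings of a policy whose first item blocks all others.

sum-⊥ : ∀ {n} (f : Fin n → ℚ) → sum (λ i → if lookup ⊥ i then f i else 0ℚ) ≡ 0ℚ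
sum-⊥ {n} f = trans
  (sum-cong-≗ λ i → cong (λ b → if b then f i else 0ℚ) (lookup-replicate i false))
  (sum-replicate-zero n)

sum-⁅⁆ : ∀ {n} (f : Fin n → ℚ) i → sum (λ j → if lookup ⁅ i ⁆ j then f j else 0ℚ) ≡ f i
sum-⁅⁆ f zero    = trans (cong (f zero +_) (sum-⊥ λ j → f (suc j))) (+-identityʳ (f zero))
sum-⁅⁆ f (suc i) = trans (+-identityˡ _) (sum-⁅⁆ (λ j → f (suc j)) i)

module _ (I : Instance) where
  open Instance I

  unitDensity⇒v≡l : UnitDensity → ∀ S → v S ≡ l S
  unitDensity⇒v≡l unit S = sum-cong-≗ λ i → cong (λ q → if lookup S i then q else 0ℚ) (unit i)

  -- Every test fails, so the walk only turns right. The bound ranges over all items, which spares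
  -- tracking the labels left in the subtree.
  packFrom-full : ∀ C S (T : Tree (Fin n)) → (∀ i → C < size i + l S) → packFrom I S T C ≡ S
  packFrom-full C S leaf         full = refl
  packFrom-full C S (node r t u) full with size r + l S ≤? C
  ... | yes fits = contradiction fits (<⇒≱ (full r))
  ... | no  _    = packFrom-full C S u full

  -- The root item `r` is fixed before the capacity is known, so the capacity may be chosen against
  -- it: with `l S`, the optimum is at least `t * size r`, the policy gets only `size r`, and the
  -- ratio `t` exceeds `α`.
  trapped : UnitDensity → Fin n → ∀ t α → 1ℚ ≤ t → α <ʳ fromℚ t →
    (∀ r → ∃ λ S → t * size r ≤ l S × (∀ i → l S < size i + size r)) →
    ¬ ∃ (Robust I α)
  trapped unit i₀ t α 1≤t (γ , 0<γ , N₁ , α+γ≤t) trap (P , robust)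
    with Policy.tree P in eq
  -- A bare leaf has the empty path, which would have to contain `i₀`.
  ... | leaf with () ← proj₂ (Policy.exactlyOnce P (subst (λ T → Path T []) (sym eq) end)) i₀
  ... | node r T U = <-irrefl refl (begin-strict
      l S                     ≤⟨ robust′ ⟩
      s * seq α m + s * ½γ    <⟨ +-monoʳ-< (s * seq α m) s½γ<sγ ⟩
      s * seq α m + s * γ     ≡⟨ *-distribˡ-+ s (seq α m) γ ⟨
      s * (seq α m + γ)       ≤⟨ *-monoˡ-≤-nonNeg s {{pos⇒nonNeg s {{positive (size>0 r)}}}}
                                   (α+γ≤t m (ℕ.m≤m⊔n N₁ N₂)) ⟩
      s * t                   ≡⟨ *-comm s t ⟩
      t * s                   ≤⟨ ts≤lS ⟩
      l S                     ∎)
    where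
    open ≤-Reasoning
    s = size r
    S = proj₁ (trap r)
    ts≤lS = proj₁ (proj₂ (trap r))
    lS<_+s = proj₂ (proj₂ (trap r))
    s≤lS : s ≤ l S
    s≤lS = begin
      s       ≡⟨ *-identityˡ s ⟨
      1ℚ * s  ≤⟨ *-monoʳ-≤-nonNeg s {{pos⇒nonNeg s {{positive (size>0 r)}}}} 1≤t ⟩
      t * s   ≤⟨ ts≤lS ⟩
      l S     ∎
    -- `S` fills the capacity exactly, and value equals size, so nothing that fits can be worth
    -- more.
    opt : IsOpt (l S) S
    opt = ≤-refl , λ T lT≤lS →
      subst₂ _≤_ (sym (unitDensity⇒v≡l unit T)) (sym (unitDensity⇒v≡l unit S)) lT≤lS
    packs-r : packFrom I ⊥ (node r T U) (l S) ≡ ⁅ r ⁆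
    packs-r with size r + l ⊥ ≤? l S
    ... | no ¬fits = contradiction
      (subst (_≤ l S) (sym (trans (cong (s +_) (sum-⊥ size)) (+-identityʳ s))) s≤lS) ¬fits
    ... | yes _ rewrite ∪-identityˡ ⁅ r ⁆ = packFrom-full (l S) ⁅ r ⁆ T λ i →
      subst (λ q → l S < size i + q) (sym (sum-⁅⁆ size r)) (lS< i +s)
    v-packing : v (packFrom I ⊥ (node r T U) (l S)) ≡ s
    v-packing = trans (cong v packs-r) (trans (unitDensity⇒v≡l unit ⁅ r ⁆) (sum-⁅⁆ size r))
    -- Robustness holds only up to a tolerance. Taking `s * ½γ`, half of the gap `s * γ` between `α`
    -- and `t` scaled by `s`, makes the chain above strict.
    ½γ = ½ * γ
    0<½γ : 0ℚ < ½γ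
    0<½γ = 0<p*q {½} (positive⁻¹ _) 0<γ
    bound = robust (l S) (≤-trans (<⇒≤ (size>0 r)) s≤lS) S opt (s * ½γ) (0<p*q (size>0 r) 0<½γ)
    N₂ = proj₁ bound
    m = N₁ ℕ.⊔ N₂
    robust′ : l S ≤ s * seq α m + s * ½γ
    robust′ = subst₂ (λ a b → a ≤ b * seq α m + s * ½γ) (unitDensity⇒v≡l unit S) v-packing
      (proj₂ bound m (ℕ.m≤n⊔m N₁ N₂))
    s½γ<sγ : s * ½γ < s * γ
    s½γ<sγ = p+q≡r⇒p<r (0<p*q (size>0 r) 0<½γ)
      (solve 2 (λ s g → s :* (con ½ :* g) :+ s :* (con ½ :* g) := s :* g) refl s γ)

-- The five items and their traps.

1≤37/25 : 1ℚ ≤ ℤ.+ 37 / 25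
1≤37/25 = p+q≡r⇒p≤r {1ℚ} {ℤ.+ 12 / 25} (nonNegative⁻¹ _) refl

module _ (t : ℚ) (t≥37/25 : ℤ.+ 37 / 25 ≤ t) (t²<t+1 : t * t < t + 1ℚ) where
  private
    open ≤-Reasoning

    2ℚ = 1ℚ + 1ℚ
    3ℚ = 1ℚ + 2ℚ

    -- The equations c = 2a/t, d = (a + c)/t and e = (c + d)/t determine the sizes up to scaling; a
    -- = t³ clears the denominators.
    a c d e : ℚ
    a = t * t * t
    c = 2ℚ * t * t
    d = t * t + 2ℚ * t
    e = 3ℚ * t + 2ℚ

    1≤t : 1ℚ ≤ t
    1≤t = ≤-trans 1≤37/25 t≥37/25

    0<t : 0ℚ < t
    0<t = <-≤-trans (positive⁻¹ 1ℚ) 1≤t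

    t<2 : t < 2ℚ
    t<2 = ≰⇒> λ 2≤t → <⇒≱ t²<t+1 (begin
      t + 1ℚ  ≤⟨ +-monoʳ-≤ t 1≤t ⟩
      t + t   ≡⟨ solve 1 (λ t → t :+ t := con 2ℚ :* t) refl t ⟩
      2ℚ * t  ≤⟨ *-monoʳ-≤-nonNeg t {{pos⇒nonNeg t {{positive 0<t}}}} 2≤t ⟩
      t * t   ∎)

    0<a : 0ℚ < a
    0<a = 0<p*q (0<p*q 0<t 0<t) 0<t

    a<c : a < c
    a<c = p+q≡r⇒p<r (0<p*q (0<p*q 0<t 0<t) (p<q⇒0<q-p t<2))
      (solve 1 (λ t → t :* t :* t :+ t :* t :* (con 2ℚ :+ :- t) := con 2ℚ :* t :* t) refl t)

    c<d : c < d
    c<d = p+q≡r⇒p<r (0<p*q 0<t (p<q⇒0<q-p t<2))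
      (solve 1 (λ t → con 2ℚ :* t :* t :+ t :* (con 2ℚ :+ :- t) := t :* t :+ con 2ℚ :* t) refl t)

    -- This is the condition that makes `φ` the threshold: 3t + 2 - t⁴ factors as (t² + t + 2)(t + 1
    -- - t²).
    ta<e : t * a < e
    ta<e = p+q≡r⇒p<r
      (0<p*q (+-mono-< (+-mono-< (0<p*q 0<t 0<t) 0<t) (positive⁻¹ 2ℚ)) (p<q⇒0<q-p t²<t+1))
      (solve 1 (λ t → t :* (t :* t :* t)
                        :+ (t :* t :+ t :+ con 2ℚ) :* (t :+ con 1ℚ :+ :- (t :* t))
                      := con 3ℚ :* t :+ con 2ℚ) refl t)

    -- With capacity `e`, the two items of size `a` must not fit together. The bound 37/25 is chosen
    -- for this: the only positive root of 2t³ - 3t - 2 lies just below 1.476.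
    e<a+a : e < a + a
    e<a+a = p+q≡r⇒p<r {e} {k₀ + tail}
      (<-≤-trans (positive⁻¹ k₀) (p+q≡r⇒p≤r {k₀} 0≤tail refl))
      (solve 1 (λ t → con 3ℚ :* t :+ con 2ℚ
                        :+ (con k₀ :+ (t :+ :- con t₀) :* (con k₁ :+ con 2ℚ :* t :* (t :+ con t₀)))
                      := t :* t :* t :+ t :* t :* t) refl t)
      where
      -- k₀ + tail is the expansion of 2t³ − 3t − 2 around t₀.
      t₀ = ℤ.+ 37 / 25
      k₀ = 2ℚ * t₀ * t₀ * t₀ - 3ℚ * t₀ - 2ℚ
      k₁ = 2ℚ * t₀ * t₀ - 3ℚ
      tail = (t - t₀) * (k₁ + 2ℚ * t * (t + t₀))
      0≤tail : 0ℚ ≤ tail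
      0≤tail = 0≤p*q (p≤q⇒0≤q-p t≥37/25)
        (+-mono-≤ {0ℚ} (nonNegative⁻¹ k₁)
          (<⇒≤ (0<p*q (0<p*q {2ℚ} (positive⁻¹ _) 0<t) (+-mono-< 0<t (positive⁻¹ t₀)))))

    c+d<a+e : c + d < a + e
    c+d<a+e = p+q≡r⇒p<r (0<p*q (p<q⇒0<q-p t<2) (p<q⇒0<q-p t²<t+1))
      (solve 1 (λ t → con 2ℚ :* t :* t :+ (t :* t :+ con 2ℚ :* t)
                        :+ (con 2ℚ :+ :- t) :* (t :+ con 1ℚ :+ :- (t :* t))
                      := t :* t :* t :+ (con 3ℚ :* t :+ con 2ℚ)) refl t)

    a≤e : a ≤ e
    a≤e = begin
      a       ≡⟨ *-identityˡ a ⟨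
      1ℚ * a  ≤⟨ *-monoʳ-≤-nonNeg a {{pos⇒nonNeg a {{positive 0<a}}}} 1≤t ⟩
      t * a   ≤⟨ <⇒≤ ta<e ⟩
      e       ∎

    sizes : Fin 5 → ℚ
    sizes = lookup (a ∷ a ∷ c ∷ d ∷ e ∷ [])

    a≤sizes : ∀ i → a ≤ sizes i
    a≤sizes 0F = ≤-refl
    a≤sizes 1F = ≤-refl
    a≤sizes 2F = <⇒≤ a<c
    a≤sizes 3F = <⇒≤ (<-trans a<c c<d)
    a≤sizes 4F = a≤e

  fiveItems : Instance
  fiveItems = record
    { n       = 5
    ; value   = sizes
    ; size    = sizes
    ; value≥0 = λ i → ≤-trans (<⇒≤ 0<a) (a≤sizes i)
    ; size>0  = λ i → <-≤-trans 0<a (a≤sizes i)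
    }

  private
    open Instance fiveItems using (l)

    -- As `a` is a smallest size, blocking it blocks every item. The parameter `q` is a closed form
    -- of `l S`, which itself unfolds to a sum with zeros for the absent items.
    trapSet : ∀ S r {q} → l S ≡ q → t * sizes r ≤ q → q < a + sizes r →
      ∃ λ S → t * sizes r ≤ l S × (∀ i → l S < sizes i + sizes r)
    trapSet S r refl tr≤lS lS<a+r =
      S , tr≤lS , λ i → <-≤-trans lS<a+r (+-monoˡ-≤ (sizes r) (a≤sizes i))

  fiveItems-trap : ∀ r → ∃ λ S → t * sizes r ≤ l S × (∀ i → l S < sizes i + sizes r)
  fiveItems-trap 0F = trapSet ⁅ 4F ⁆ 0F
    (solve 1 (λ e → con 0ℚ :+ (con 0ℚ :+ (con 0ℚ :+ (con 0ℚ :+ (e :+ con 0ℚ)))) := e) refl e)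
    (<⇒≤ ta<e) e<a+a
  -- Both items have size `a`, so the set containing only the item of size `e` traps either.
  fiveItems-trap 1F = fiveItems-trap 0F
  fiveItems-trap 2F = trapSet (⁅ 0F ⁆ ∪ ⁅ 1F ⁆) 2F
    (solve 1 (λ a → a :+ (a :+ con 0ℚ) := a :+ a) refl a)
    (≤-reflexive (solve 1 (λ t → t :* (con 2ℚ :* t :* t) := t :* t :* t :+ t :* t :* t) refl t))
    (+-monoʳ-< a a<c)
  fiveItems-trap 3F = trapSet (⁅ 0F ⁆ ∪ ⁅ 2F ⁆) 3F
    (solve 2 (λ a c → a :+ (con 0ℚ :+ (c :+ con 0ℚ)) := a :+ c) refl a c)
    (≤-reflexive (solve 1 (λ t → t :* (t :* t :+ con 2ℚ :* t)
                                 := t :* t :* t :+ con 2ℚ :* t :* t) refl t))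
    (+-monoʳ-< a c<d)
  fiveItems-trap 4F = trapSet (⁅ 2F ⁆ ∪ ⁅ 3F ⁆) 4F
    (solve 2 (λ c d → con 0ℚ :+ (con 0ℚ :+ (c :+ (d :+ con 0ℚ))) := c :+ d) refl c d)
    (≤-reflexive (solve 1 (λ t → t :* (con 3ℚ :* t :+ con 2ℚ)
                                 := con 2ℚ :* t :* t :+ (t :* t :+ con 2ℚ :* t)) refl t))
    c+d<a+e

theorem11 : ∀ (δ : ℝ) → fromℚ 0ℚ <ʳ δ →
    ∃ λ (I : Instance) → Instance.UnitDensity I ×
    ¬ (∃ λ (P : Policy I) → Robust I (φ -ʳ δ) P)
theorem11 δ 0<δ =
  -- However large `δ` is, `t` is at least 37/25, so no case distinction on `δ` arises.
  let t , α<t , t≥37/25 , t²<t+1 = below-φ (φ -ʳ δ) (x-δ<x φ δ 0<δ)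
      I = fiveItems t t≥37/25 t²<t+1
      1≤t = ≤-trans 1≤37/25 t≥37/25
  in I , (λ _ → refl) ,
     trapped I (λ _ → refl) 0F t (φ -ʳ δ) 1≤t α<t (fiveItems-trap t t≥37/25 t²<t+1)
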